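{- Let $(a_n)_{n\geq 1}$ and $(b_n)_{n\geq 1}$ be the sequences defined by \[a_n=\sum_{k=1}^{\left\lfloor\frac{n-1}{2}\right\rfloor}\left(2k^2+2(n-k)^2+k(n-k)\right),\qquad b_n=\sum_{k=1}^{\left\lfloor\frac n3\right\rfloor}\ \sum_{i=k}^{\left\lfloor\frac{n-k}{2}\right\rfloor} ik(n-i-k).\] Let $A(x)=\sum_{n\geq 1}a_nx^n$ and $B(x)=\sum_{n\geq 1}b_nx^n$ be the generating functions of the two sequences, respectively. Then \[A(x)=\frac{x^3(2x^3+11x^2+11x+12)}{(1-x)^4(1+x)^3},\] \[B(x)=\frac{x^3(6x^8+14x^7+18x^6+21x^5+23x^4+15x^3+7x^2+3x+1)}{(1-x)^6(1+x)^3(x^2+x+1)^4}.\]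
   Context: Empty sums are equal to $0$. The identities are identities of formal power series. -}

module Defs where

open import Algebra.Bundles using (RawRing)
import Algebra.Definitions.RawSemiring as RawSemiringDefs
import Algebra.Properties.CommutativeMonoid.Sum as Sum
open import Data.Fin.Base using (Fin; zero; suc; toℕ)
open import Data.Integer.Base as ℤ using (ℤ; +_; 0ℤ; 1ℤ)
import Data.Integer.Properties as ℤ
open import Data.Nat.Base as ℕ using (ℕ; zero; suc; _∸_)
open import Data.Nat.DivMod using () renaming (_/_ to _div_)
import Data.Nat.Properties as ℕ
open import Data.Vec.Functional using (Vector; []; _∷_)
open import Level using (0ℓ)
open import Relation.Binary.PropositionalEquality
open import Relation.Nullary.Decidable using (True; toWitness)

module ℕ-Sum = Sum ℕ.+-0-commutativeMonoid
module ℤ-Sum = Sum ℤ.+-0-commutativeMonoid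

-- The number of terms is suc n ∸ m, so the sum is empty (and 0) when n < m.
sum-range : ℕ → ℕ → (ℕ → ℕ) → ℕ
sum-range m n f = ℕ-Sum.sum {suc n ∸ m} (λ j → f (m ℕ.+ toℕ j))

infixl 5 sum-range
syntax sum-range m n (λ k → x) = ∑[ k from m to n ] x

-- In a and b the truncated subtractions never truncate when n ≥ 1 and the
-- indices lie in the ranges of summation.  Only n ≥ 1 is relevant.
a : ℕ → ℕ
a n = ∑[ k from 1 to (n ∸ 1) div 2 ]
        (2 ℕ.* k ℕ.^ 2 ℕ.+ 2 ℕ.* (n ∸ k) ℕ.^ 2 ℕ.+ k ℕ.* (n ∸ k))

b : ℕ → ℕ
b n = ∑[ k from 1 to n div 3 ] ∑[ i from k to (n ∸ k) div 2 ]
        (i ℕ.* k ℕ.* (n ∸ i ∸ k))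

-- Formal power series over ℤ, as coefficient sequences.
Series : Set
Series = ℕ → ℤ

series-rawRing : RawRing 0ℓ 0ℓ
series-rawRing = record
  { Carrier = Series
  ; _≈_     = _≗_
  ; _+_     = λ f g n → f n ℤ.+ g n
  ; _*_     = λ f g n → ℤ-Sum.sum {suc n} (λ i → f (toℕ i) ℤ.* g (n ∸ toℕ i))
  ; -_      = λ f n → ℤ.- f n
  ; 0#      = λ _ → 0ℤ
  ; 1#      = λ { zero → 1ℤ ; (suc _) → 0ℤ }
  }

open RawRing series-rawRing public
  using (_≈_; _+_; _*_; -_; 0#; 1#; rawSemiring)

open RawSemiringDefs rawSemiring public
  using (_^_) renaming (_×_ to _·_)

infixl 6 _-_
_-_ : Series → Series → Series
f - g = f + - g

X : Series
X 1 = 1ℤ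
X _ = 0ℤ

-- The first n coefficients of the quotient, that of Xⁿ⁻¹ first.
quotientCoeffs : Series → Series → ∀ n → Vector ℤ n
quotientCoeffs P Q zero    = []
quotientCoeffs P Q (suc n) =
  (P n ℤ.- ℤ-Sum.sum (λ i → Q (suc (toℕ i)) ℤ.* quotientCoeffs P Q n i))
  ∷ quotientCoeffs P Q n

-- Only divisors with constant term 1 are allowed.  They are invertible in
-- ℤ[[X]], so P / Q is the only series satisfying *-/-cancel.
infixl 7 _/_
_/_ : (P Q : Series) {Q₀≡1 : True (Q 0 ℤ.≟ 1ℤ)} → Series
(P / Q) n = quotientCoeffs P Q (suc n) zero

*-/-cancel : ∀ P Q {Q₀≡1 : True (Q 0 ℤ.≟ 1ℤ)} → Q * (P / Q) {Q₀≡1} ≈ P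
*-/-cancel P Q {Q₀≡1} n = begin
  Q 0 ℤ.* R n ℤ.+ ℤ-Sum.sum (λ i → Q (suc (toℕ {n} i)) ℤ.* R (n ∸ suc (toℕ i)))
    ≡⟨ cong₂ ℤ._+_
         (trans (cong (ℤ._* R n) (toWitness Q₀≡1)) (ℤ.*-identityˡ (R n)))
         (ℤ-Sum.sum-cong-≗ (λ i → cong (Q (suc (toℕ i)) ℤ.*_) (sym (entry n i)))) ⟩
  (P n ℤ.- S) ℤ.+ S
    ≡⟨ ℤ.+-assoc (P n) (ℤ.- S) S ⟩
  P n ℤ.+ (ℤ.- S ℤ.+ S)
    ≡⟨ cong (λ z → P n ℤ.+ z) (ℤ.+-inverseˡ S) ⟩
  P n ℤ.+ 0ℤ
    ≡⟨ ℤ.+-identityʳ (P n) ⟩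
  P n ∎
  where
  open ≡-Reasoning
  R = (P / Q) {Q₀≡1}
  S = ℤ-Sum.sum (λ i → Q (suc (toℕ i)) ℤ.* quotientCoeffs P Q n i)

  entry : ∀ m (i : Fin m) → quotientCoeffs P Q m i ≡ R (m ∸ suc (toℕ i))
  entry (suc m) zero    = refl
  entry (suc m) (suc i) = entry m i

-- ∑_{n ≥ 1} sₙ Xⁿ
generatingFunction : (ℕ → ℕ) → Series
generatingFunction s zero    = 0ℤ
generatingFunction s (suc n) = + s (suc n)

A B : Series
A = generatingFunction a
B = generatingFunction b

{-# OPTIONS --safe #-}

-- With n = 3 + 2k + m for a, and i = k + v, n = 3k + 2v + w for b, the
-- coefficients become sums over free indices:
--   A = X³ ∑_k X^{2k} ∑_m X^m p(k, m),   B = ∑_k X^{3k} ∑_v X^{2v} ∑_w X^w q(k, v, w),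
-- where p and q are polynomials of degree at most 3 in each index.  A sum
-- ∑_j y^j g(j) with g cubic has denominator (1 - y)⁴, so eliminating the indices
-- one after another, from the inside, leaves identities between polynomials in X.

module Submission where

open import Algebra.Bundles using (CommutativeRing; Semiring)
import Algebra.Definitions.RawSemiring as RawSemiringDefinitions
import Algebra.Properties.AbelianGroup as AbelianGroupProperties
import Algebra.Properties.CommutativeSemigroup as CommutativeSemigroupProperties
import Algebra.Properties.Group as GroupProperties
import Algebra.Properties.Ring as RingProperties
import Algebra.Properties.Semiring.Exp as SemiringExp
import Algebra.Properties.Semiring.Mult as SemiringMult
import Algebra.Solver.Ring as RingSolver
open import Algebra.Solver.Ring.AlmostCommutativeRing
  using (fromCommutativeRing; _-Raw-AlmostCommutative⟶_)
open import Algebra.Structures using (IsCommutativeRing)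
open import Data.Fin.Base using (toℕ)
open import Data.Integer.Base as ℤ using (ℤ; +_; -[1+_]; 0ℤ; 1ℤ)
import Data.Integer.Properties as ℤ
import Data.Integer.Solver as ℤ
open import Data.Maybe.Base using (just; nothing)
open import Data.Nat.Base as ℕ using (ℕ; zero; suc; _∸_; s≤s; z≤n)
import Data.Nat.Divisibility as ℕ
open import Data.Nat.DivMod using () renaming (_/_ to _div_)
import Data.Nat.DivMod as ℕ
open import Data.Nat.Induction using (<-rec)
import Data.Nat.Properties as ℕ
import Data.Nat.Solver as ℕ
open import Data.Product.Base using (_×_; _,_; ∃)
open import Data.Sum.Base using (_⊎_; inj₁; inj₂)
open import Function.Base using (_∘_)
open import Level using (0ℓ)
open import Relation.Binary.Definitions using (WeaklyDecidable)
open import Relation.Binary.PropositionalEquality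
  using (_≡_; refl; sym; trans; cong; cong₂; module ≡-Reasoning)
import Relation.Binary.Reasoning.Setoid as SetoidReasoning
open import Relation.Nullary.Decidable using (True; fromWitness; yes; no)

-- Summands in free indices, and the shape of the two fractions.

-- The summand of a (3 + n) at index 1 + k, where n = 2k + m.
a-summand : ℕ → ℕ → ℕ
a-summand k m = 2 ℕ.* (1 ℕ.+ k) ℕ.^ 2 ℕ.+ 2 ℕ.* (2 ℕ.+ (k ℕ.+ m)) ℕ.^ 2
                ℕ.+ (1 ℕ.+ k) ℕ.* (2 ℕ.+ (k ℕ.+ m))

-- The summand of b n at k and i = k + v, where n = 3k + 2v + w.
b-summand : ℕ → ℕ → ℕ → ℕ
b-summand k v w = k ℕ.* (k ℕ.+ v) ℕ.* (k ℕ.+ v ℕ.+ w)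

-- K C P Q for the numerator P and the denominator Q of A and B, where C is the
-- surplus factor that eliminating the indices leaves in both.  Over Series, the
-- type checker cannot afford to unfold products as long as these.  Since the two
-- types are records, it compares instances of them parameter by parameter.
module Fractions {a k} {A : Set a}
  (add mul sub : A → A → A) (one : A) (pow : A → ℕ → A) (times : ℕ → A → A)
  (x : A) (K : (C P Q : A) → Set k) where

  record A-Fraction : Set k where
    field
      property :
        let infixl 6 _+_ _-_
            infixl 7 _*_
            infixr 8 _^_ _·_
            _+_ = add
            _-_ = sub
            _*_ = mul
            _^_ = pow
            _·_ = times
        in K ((one - x) ^ 4 * (one + x))
             (x ^ 3 * (2 · x ^ 3 + 11 · x ^ 2 + 11 · x + 12 · one))
             ((one - x) ^ 4 * (one + x) ^ 3)

  record B-Fraction : Set k where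
    field
      property :
        let infixl 6 _+_ _-_
            infixl 7 _*_
            infixr 8 _^_ _·_
            _+_ = add
            _-_ = sub
            _*_ = mul
            _^_ = pow
            _·_ = times
        in K ((one - x) ^ 6 * (one + x))
             (x ^ 3 * (6 · x ^ 8 + 14 · x ^ 7 + 18 · x ^ 6 + 21 · x ^ 5
                       + 23 · x ^ 4 + 15 · x ^ 3 + 7 · x ^ 2 + 3 · x + one))
             ((one - x) ^ 6 * (one + x) ^ 3 * (x ^ 2 + x + one) ^ 4)

-- Integers as constants in a commutative ring.

module Integers {c ℓ} (R : CommutativeRing c ℓ) where
  open CommutativeRing R hiding (zero) renaming (refl to ≈-refl; sym to ≈-sym; trans to ≈-trans)
  open AbelianGroupProperties +-abelianGroup using (⁻¹-∙-comm)
  open GroupProperties +-group using (ε⁻¹≈ε; ⁻¹-involutive)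
  open RingProperties ring using (-‿distribˡ-*; -‿distribʳ-*)
  open SemiringExp semiring using (_^_)
  open SemiringMult semiring public using (×-homo-+; ×1-homo-*) renaming (_×_ to _·_)
  open SetoidReasoning setoid

  ×1-homo-^ : ∀ m n → (m ℕ.^ n) · 1# ≈ (m · 1#) ^ n
  ×1-homo-^ m zero    = +-identityʳ 1#
  ×1-homo-^ m (suc n) = ≈-trans (×1-homo-* m (m ℕ.^ n)) (*-congˡ (×1-homo-^ m n))

  -- The value at + n is n · 1# on the nose, so that numerals n · x are
  -- constants for the ring solver.
  ⟦_⟧ : ℤ → Carrier
  ⟦ + n ⟧      = n · 1#
  ⟦ -[1+ n ] ⟧ = - (suc n · 1#)

  cancel-1# : ∀ a b → (1# + a) - (1# + b) ≈ a - b
  cancel-1# a b = begin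
    (1# + a) - (1# + b)        ≈⟨ +-cong (+-comm 1# a) (≈-sym (⁻¹-∙-comm 1# b)) ⟩
    (a + 1#) + (- 1# - b)      ≈⟨ +-assoc a 1# (- 1# - b) ⟩
    a + (1# + (- 1# - b))      ≈⟨ +-congˡ (+-assoc 1# (- 1#) (- b)) ⟨
    a + ((1# - 1#) - b)        ≈⟨ +-congˡ (+-congʳ (-‿inverseʳ 1#)) ⟩
    a + (0# - b)               ≈⟨ +-congˡ (+-identityˡ (- b)) ⟩
    a - b                      ∎

  ⊖-homo : ∀ m n → ⟦ m ℤ.⊖ n ⟧ ≈ m · 1# - n · 1#
  ⊖-homo m       zero    = ≈-sym (≈-trans (+-congˡ ε⁻¹≈ε) (+-identityʳ (m · 1#)))
  ⊖-homo zero    (suc n) = ≈-sym (+-identityˡ _)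
  ⊖-homo (suc m) (suc n) = begin
    ⟦ suc m ℤ.⊖ suc n ⟧    ≡⟨ cong ⟦_⟧ (ℤ.[1+m]⊖[1+n]≡m⊖n m n) ⟩
    ⟦ m ℤ.⊖ n ⟧            ≈⟨ ⊖-homo m n ⟩
    m · 1# - n · 1#        ≈⟨ cancel-1# (m · 1#) (n · 1#) ⟨
    suc m · 1# - suc n · 1# ∎

  -‿homo : ∀ i → ⟦ ℤ.- i ⟧ ≈ - ⟦ i ⟧
  -‿homo (+ zero)  = ≈-sym ε⁻¹≈ε
  -‿homo (+ suc n) = ≈-refl
  -‿homo -[1+ n ]  = ≈-sym (⁻¹-involutive (suc n · 1#))

  +-homo : ∀ i j → ⟦ i ℤ.+ j ⟧ ≈ ⟦ i ⟧ + ⟦ j ⟧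
  +-homo (+ m)    (+ n)    = ×-homo-+ 1# m n
  +-homo (+ m)    -[1+ n ] = ⊖-homo m (suc n)
  +-homo -[1+ m ] (+ n)    = ≈-trans (⊖-homo n (suc m)) (+-comm _ _)
  +-homo -[1+ m ] -[1+ n ] = begin
    ⟦ -[1+ m ] ℤ.+ -[1+ n ] ⟧          ≡⟨ cong ⟦_⟧ (ℤ.neg-distrib-+ (+ suc m) (+ suc n)) ⟨
    ⟦ ℤ.- (+ (suc m ℕ.+ suc n)) ⟧      ≈⟨ -‿homo (+ (suc m ℕ.+ suc n)) ⟩
    - ((suc m ℕ.+ suc n) · 1#)         ≈⟨ -‿cong (×-homo-+ 1# (suc m) (suc n)) ⟩
    - (suc m · 1# + suc n · 1#)        ≈⟨ ⁻¹-∙-comm (suc m · 1#) (suc n · 1#) ⟨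
    - (suc m · 1#) - suc n · 1#        ∎

  pos-*-homo : ∀ m j → ⟦ + m ℤ.* j ⟧ ≈ ⟦ + m ⟧ * ⟦ j ⟧
  pos-*-homo m (+ n)    = ≈-trans (reflexive (cong ⟦_⟧ (sym (ℤ.pos-* m n)))) (×1-homo-* m n)
  pos-*-homo m -[1+ n ] = begin
    ⟦ + m ℤ.* -[1+ n ] ⟧         ≡⟨ cong ⟦_⟧ (ℤ.neg-distribʳ-* (+ m) (+ suc n)) ⟨
    ⟦ ℤ.- (+ m ℤ.* + suc n) ⟧    ≈⟨ -‿homo (+ m ℤ.* + suc n) ⟩
    - ⟦ + m ℤ.* + suc n ⟧        ≈⟨ -‿cong (pos-*-homo m (+ suc n)) ⟩
    - ((m · 1#) * (suc n · 1#))  ≈⟨ -‿distribʳ-* (m · 1#) (suc n · 1#) ⟩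
    (m · 1#) * - (suc n · 1#)    ∎

  *-homo : ∀ i j → ⟦ i ℤ.* j ⟧ ≈ ⟦ i ⟧ * ⟦ j ⟧
  *-homo (+ m)    j = pos-*-homo m j
  *-homo -[1+ m ] j = begin
    ⟦ -[1+ m ] ℤ.* j ⟧           ≡⟨ cong ⟦_⟧ (ℤ.neg-distribˡ-* (+ suc m) j) ⟨
    ⟦ ℤ.- (+ suc m ℤ.* j) ⟧      ≈⟨ -‿homo (+ suc m ℤ.* j) ⟩
    - ⟦ + suc m ℤ.* j ⟧          ≈⟨ -‿cong (pos-*-homo (suc m) j) ⟩
    - ((suc m · 1#) * ⟦ j ⟧)     ≈⟨ -‿distribˡ-* (suc m · 1#) ⟦ j ⟧ ⟩
    - (suc m · 1#) * ⟦ j ⟧       ∎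

  homomorphism : ℤ.+-*-rawRing -Raw-AlmostCommutative⟶ fromCommutativeRing R
  homomorphism = record
    { ⟦_⟧    = ⟦_⟧
    ; +-homo = +-homo
    ; *-homo = *-homo
    ; -‿homo = -‿homo
    ; 0-homo = ≈-refl
    ; 1-homo = +-identityʳ 1#
    }

  -- Equal integers have equal images. The converse may fail in positive characteristic, so distinct
  -- integers leave the question open.
  _coeff≟_ : WeaklyDecidable (λ i j → ⟦ i ⟧ ≈ ⟦ j ⟧)
  i coeff≟ j with i ℤ.≟ j
  ... | yes i≡j = just (reflexive (cong ⟦_⟧ i≡j))
  ... | no  _   = nothing

  open RingSolver ℤ.+-*-rawRing (fromCommutativeRing R) homomorphism _coeff≟_ public
    using (Polynomial; solve; con; _:+_; _:*_; _:-_; _:^_; _:×_; _:=_)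

-- Polynomial identities behind the sums of cubics.

module Identities {c ℓ} (R : CommutativeRing c ℓ) where
  open CommutativeRing R hiding (zero; refl; sym; trans)
  open Integers R
    using (×-homo-+; ×1-homo-*; ×1-homo-^; Polynomial; solve; con; _:+_; _:*_; _:-_; _:^_; _:×_; _:=_)
  open RawSemiringDefinitions (Semiring.rawSemiring semiring) using (_^_) renaming (_×_ to _·_)
  open CommutativeSemigroupProperties *-commutativeSemigroup using (x∙yz≈y∙xz)
  open SetoidReasoning setoid

  ≈-refl : ∀ {x} → x ≈ x
  ≈-refl = CommutativeRing.refl R

  -- Unlike con 1ℤ, this denotes 1# on the nose.
  :1 : ∀ {n} → Polynomial n
  :1 = con 1ℤ :^ 0

  :0 : ∀ {n} → Polynomial n
  :0 = con 0ℤ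

  cubic : (t g₀ g₁ g₂ g₃ : Carrier) → Carrier
  cubic t g₀ g₁ g₂ g₃ = g₀ + g₁ * t + g₂ * t ^ 2 + g₃ * t ^ 3

  :cubic : ∀ {n} (t g₀ g₁ g₂ g₃ : Polynomial n) → Polynomial n
  :cubic t g₀ g₁ g₂ g₃ = g₀ :+ g₁ :* t :+ g₂ :* t :^ 2 :+ g₃ :* t :^ 3

  -- (1 - y)⁴ ∑_{j ≥ 0} y^j cubic (t + j), summed by means of the Eulerian
  -- polynomials 1, y, y + y² and y + 4y² + y³.
  cubic-sum : (y t g₀ g₁ g₂ g₃ : Carrier) → Carrier
  cubic-sum y t g₀ g₁ g₂ g₃ =
    let p = 1# - y
        e = y + y ^ 2
    in
      g₀ * p ^ 3
    + g₁ * (t * p ^ 3 + y * p ^ 2)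
    + g₂ * (t ^ 2 * p ^ 3 + 2 · t * y * p ^ 2 + e * p)
    + g₃ * (t ^ 3 * p ^ 3 + 3 · t ^ 2 * y * p ^ 2 + 3 · t * e * p + (y + 4 · y ^ 2 + y ^ 3))

  :cubic-sum : ∀ {n} (y t g₀ g₁ g₂ g₃ : Polynomial n) → Polynomial n
  :cubic-sum y t g₀ g₁ g₂ g₃ =
    let p = :1 :- y
        e = y :+ y :^ 2
    in
       g₀ :* p :^ 3
    :+ g₁ :* (t :* p :^ 3 :+ y :* p :^ 2)
    :+ g₂ :* (t :^ 2 :* p :^ 3 :+ 2 :× t :* y :* p :^ 2 :+ e :* p)
    :+ g₃ :* (t :^ 3 :* p :^ 3 :+ 3 :× t :^ 2 :* y :* p :^ 2 :+ 3 :× t :* e :* p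
              :+ (y :+ 4 :× y :^ 2 :+ y :^ 3))

  -- The term j = 0 splits off, and the rest is y times the same sum started at t + 1. Cleared of
  -- denominators this is a polynomial identity, so neither convergence nor division is involved.
  cubic-sum-step : ∀ y t g₀ g₁ g₂ g₃ → cubic-sum y t g₀ g₁ g₂ g₃ ≈
    (1# - y) ^ 4 * cubic t g₀ g₁ g₂ g₃ + y * cubic-sum y (1# + t) g₀ g₁ g₂ g₃
  cubic-sum-step = solve 6 (λ y t g₀ g₁ g₂ g₃ →
    :cubic-sum y t g₀ g₁ g₂ g₃ :=
    (:1 :- y) :^ 4 :* :cubic t g₀ g₁ g₂ g₃ :+ y :* :cubic-sum y (:1 :+ t) g₀ g₁ g₂ g₃) ≈-refl

  *-scale-unfold : ∀ c g y s → c * (g + y * s) ≈ c * g + y * (c * s)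
  *-scale-unfold = solve 4 (λ c g y s → c :* (g :+ y :* s) := c :* g :+ y :* (c :* s)) ≈-refl

  -- Brings `cubic-sum-step` into the form of the recurrence in `IsSum`. Here `c` is the denominator
  -- left by the inner sums, and each elimination multiplies it by (1 - y)⁴.
  cubic-sum-unfold : ∀ y c f j g₀ g₁ g₂ g₃ → c * f ≈ cubic (j · 1#) g₀ g₁ g₂ g₃ →
    cubic-sum y (j · 1#) g₀ g₁ g₂ g₃
    ≈ ((1# - y) ^ 4 * c) * f + y * cubic-sum y (suc j · 1#) g₀ g₁ g₂ g₃
  cubic-sum-unfold y c f j g₀ g₁ g₂ g₃ cf≈cubic = begin
    cubic-sum y (j · 1#) g₀ g₁ g₂ g₃
      ≈⟨ cubic-sum-step y (j · 1#) g₀ g₁ g₂ g₃ ⟩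
    (1# - y) ^ 4 * cubic (j · 1#) g₀ g₁ g₂ g₃ + y * cubic-sum y (suc j · 1#) g₀ g₁ g₂ g₃
      ≈⟨ +-congʳ (*-congˡ cf≈cubic) ⟨
    (1# - y) ^ 4 * (c * f) + y * cubic-sum y (suc j · 1#) g₀ g₁ g₂ g₃
      ≈⟨ +-congʳ (*-assoc ((1# - y) ^ 4) c f) ⟨
    ((1# - y) ^ 4 * c) * f + y * cubic-sum y (suc j · 1#) g₀ g₁ g₂ g₃ ∎

  -- The factor `1#` is the denominator before any index has been eliminated, in the form that
  -- `sum-cubic` expects.
  a-summand-expand : ∀ K M →
    1# * ((2 · 1#) * (1# + K) ^ 2 + (2 · 1#) * (1# + (1# + (K + M))) ^ 2
          + (1# + K) * (1# + (1# + (K + M))))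
    ≈ cubic M (12 · 1# + 15 · K + 5 · K ^ 2) (9 · 1# + 5 · K) (2 · 1#) 0#
  a-summand-expand = solve 2 (λ K M →
    :1 :* ((2 :× :1) :* (:1 :+ K) :^ 2 :+ (2 :× :1) :* (:1 :+ (:1 :+ (K :+ M))) :^ 2
           :+ (:1 :+ K) :* (:1 :+ (:1 :+ (K :+ M))))
    := :cubic M (12 :× :1 :+ 15 :× K :+ 5 :× K :^ 2) (9 :× :1 :+ 5 :× K) (2 :× :1) :0) ≈-refl

  a-summand-cubic : ∀ k m → let K = k · 1# in 1# * (a-summand k m · 1#)
    ≈ cubic (m · 1#) (12 · 1# + 15 · K + 5 · K ^ 2) (9 · 1# + 5 · K) (2 · 1#) 0#
  a-summand-cubic k m = begin
    1# * (a-summand k m · 1#)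
      ≈⟨ *-congˡ (×-homo-+ 1# (2 ℕ.* i ℕ.^ 2 ℕ.+ 2 ℕ.* j ℕ.^ 2) (i ℕ.* j)) ⟩
    1# * ((2 ℕ.* i ℕ.^ 2 ℕ.+ 2 ℕ.* j ℕ.^ 2) · 1# + (i ℕ.* j) · 1#)
      ≈⟨ *-congˡ (+-cong (×-homo-+ 1# (2 ℕ.* i ℕ.^ 2) (2 ℕ.* j ℕ.^ 2)) (×1-homo-* i j)) ⟩
    1# * ((2 ℕ.* i ℕ.^ 2) · 1# + (2 ℕ.* j ℕ.^ 2) · 1# + (i · 1#) * (j · 1#))
      ≈⟨ *-congˡ (+-cong (+-cong twice-i² twice-j²) (*-congˡ j≈)) ⟩
    1# * ((2 · 1#) * (i · 1#) ^ 2 + (2 · 1#) * J ^ 2 + (i · 1#) * J)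
      ≈⟨ a-summand-expand (k · 1#) (m · 1#) ⟩
    cubic (m · 1#) (12 · 1# + 15 · k · 1# + 5 · (k · 1#) ^ 2) (9 · 1# + 5 · k · 1#) (2 · 1#) 0# ∎
    where
    i = 1 ℕ.+ k
    j = 2 ℕ.+ (k ℕ.+ m)
    J = 1# + (1# + (k · 1# + m · 1#))
    j≈ : j · 1# ≈ J
    j≈ = +-congˡ (+-congˡ (×-homo-+ 1# k m))
    twice-i² : (2 ℕ.* i ℕ.^ 2) · 1# ≈ (2 · 1#) * (i · 1#) ^ 2
    twice-i² = CommutativeRing.trans R (×1-homo-* 2 (i ℕ.^ 2)) (*-congˡ (×1-homo-^ i 2))
    twice-j² : (2 ℕ.* j ℕ.^ 2) · 1# ≈ (2 · 1#) * J ^ 2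
    twice-j² = CommutativeRing.trans R (×1-homo-* 2 (j ℕ.^ 2))
      (*-congˡ (CommutativeRing.trans R (×1-homo-^ j 2) (*-cong j≈ (*-congʳ j≈))))

  -- Regroups (1 - x)⁴ times the sum over m as a polynomial in `K`, so that k can be summed next.
  -- The exponent in `x ^ 1` matches the general step `X ^ d`.
  a-row-cubic : ∀ x K → let p = 1# - x ^ 1 in
    cubic-sum (x ^ 1) 0# (12 · 1# + 15 · K + 5 · K ^ 2) (9 · 1# + 5 · K) (2 · 1#) 0#
    ≈ cubic K (12 · p ^ 3 + 9 · x * p ^ 2 + 2 · (x + x ^ 2) * p)
              (15 · p ^ 3 + 5 · x * p ^ 2) (5 · p ^ 3) 0#
  a-row-cubic = solve 2 (λ x K → let p = :1 :- x :^ 1 in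
    :cubic-sum (x :^ 1) :0 (12 :× :1 :+ 15 :× K :+ 5 :× K :^ 2) (9 :× :1 :+ 5 :× K) (2 :× :1) :0
    := :cubic K (12 :× p :^ 3 :+ 9 :× x :* p :^ 2 :+ 2 :× (x :+ x :^ 2) :* p)
                (15 :× p :^ 3 :+ 5 :× x :* p :^ 2) (5 :× p :^ 3) :0) ≈-refl

  -- The sum over k has y = x². The denominator it leaves is (1 - x²)⁴(1 - x)⁴ = (1 - x)⁸(1 + x)⁴,
  -- which exceeds the desired one by the factor (1 - x)⁴(1 + x) split off here.
  a-numerator : ∀ x → let p = 1# - x ^ 1 in
    cubic-sum (x ^ 2) 0# (12 · p ^ 3 + 9 · x * p ^ 2 + 2 · (x + x ^ 2) * p)
                         (15 · p ^ 3 + 5 · x * p ^ 2) (5 · p ^ 3) 0#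
    ≈ ((1# - x) ^ 4 * (1# + x)) * (2 · x ^ 3 + 11 · x ^ 2 + 11 · x + 12 · 1#)
  a-numerator = solve 1 (λ x → let p = :1 :- x :^ 1 in
    :cubic-sum (x :^ 2) :0 (12 :× p :^ 3 :+ 9 :× x :* p :^ 2 :+ 2 :× (x :+ x :^ 2) :* p)
                           (15 :× p :^ 3 :+ 5 :× x :* p :^ 2) (5 :× p :^ 3) :0
    := ((:1 :- x) :^ 4 :* (:1 :+ x)) :* (2 :× x :^ 3 :+ 11 :× x :^ 2 :+ 11 :× x :+ 12 :× :1)) ≈-refl

  a-denominator : ∀ x →
    ((1# - x) ^ 4 * (1# + x)) * ((1# - x) ^ 4 * (1# + x) ^ 3)
    ≈ (1# - x ^ 2) ^ 4 * ((1# - x ^ 1) ^ 4 * 1#)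
  a-denominator = solve 1 (λ x →
    ((:1 :- x) :^ 4 :* (:1 :+ x)) :* ((:1 :- x) :^ 4 :* (:1 :+ x) :^ 3)
    := (:1 :- x :^ 2) :^ 4 :* ((:1 :- x :^ 1) :^ 4 :* :1)) ≈-refl

  b-summand-expand : ∀ K V W → 1# * (K * (K + V) * (K + V + W))
    ≈ cubic W (K * (K + V) ^ 2) (K * (K + V)) 0# 0#
  b-summand-expand = solve 3 (λ K V W → :1 :* (K :* (K :+ V) :* (K :+ V :+ W))
    := :cubic W (K :* (K :+ V) :^ 2) (K :* (K :+ V)) :0 :0) ≈-refl

  b-summand-cubic : ∀ k v w → let K = k · 1# ; V = v · 1# in
    1# * (b-summand k v w · 1#) ≈ cubic (w · 1#) (K * (K + V) ^ 2) (K * (K + V)) 0# 0#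
  b-summand-cubic k v w = begin
    1# * (b-summand k v w · 1#)
      ≈⟨ *-congˡ (×1-homo-* (k ℕ.* (k ℕ.+ v)) (k ℕ.+ v ℕ.+ w)) ⟩
    1# * ((k ℕ.* (k ℕ.+ v)) · 1# * (k ℕ.+ v ℕ.+ w) · 1#)
      ≈⟨ *-congˡ (*-cong (×1-homo-* k (k ℕ.+ v)) (×-homo-+ 1# (k ℕ.+ v) w)) ⟩
    1# * (K * (k ℕ.+ v) · 1# * ((k ℕ.+ v) · 1# + W))
      ≈⟨ *-congˡ (*-cong (*-congˡ (×-homo-+ 1# k v)) (+-congʳ (×-homo-+ 1# k v))) ⟩
    1# * (K * (K + V) * (K + V + W))
      ≈⟨ b-summand-expand K V W ⟩
    cubic W (K * (K + V) ^ 2) (K * (K + V)) 0# 0# ∎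
    where
    K = k · 1#
    V = v · 1#
    W = w · 1#

  b-row-cubic : ∀ x K V → let p = 1# - x ^ 1 in
    cubic-sum (x ^ 1) 0# (K * (K + V) ^ 2) (K * (K + V)) 0# 0#
    ≈ cubic V (K ^ 3 * p ^ 3 + K ^ 2 * x * p ^ 2) (2 · K ^ 2 * p ^ 3 + K * x * p ^ 2) (K * p ^ 3) 0#
  b-row-cubic = solve 3 (λ x K V → let p = :1 :- x :^ 1 in
    :cubic-sum (x :^ 1) :0 (K :* (K :+ V) :^ 2) (K :* (K :+ V)) :0 :0
    := :cubic V (K :^ 3 :* p :^ 3 :+ K :^ 2 :* x :* p :^ 2)
                (2 :× K :^ 2 :* p :^ 3 :+ K :* x :* p :^ 2) (K :* p :^ 3) :0) ≈-refl

  -- Every term keeps the factor `K` of the summand, hence the constant coefficient `0#`.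
  b-layer-cubic : ∀ x K → let p = 1# - x ^ 1 ; y = x ^ 2 ; q = 1# - y in
    cubic-sum y 0# (K ^ 3 * p ^ 3 + K ^ 2 * x * p ^ 2) (2 · K ^ 2 * p ^ 3 + K * x * p ^ 2) (K * p ^ 3) 0#
    ≈ cubic K 0# (x * p ^ 2 * y * q ^ 2 + p ^ 3 * (y + y ^ 2) * q)
                 (x * p ^ 2 * q ^ 3 + 2 · p ^ 3 * y * q ^ 2) (p ^ 3 * q ^ 3)
  b-layer-cubic = solve 2 (λ x K → let p = :1 :- x :^ 1 ; y = x :^ 2 ; q = :1 :- y in
    :cubic-sum y :0 (K :^ 3 :* p :^ 3 :+ K :^ 2 :* x :* p :^ 2)
                    (2 :× K :^ 2 :* p :^ 3 :+ K :* x :* p :^ 2) (K :* p :^ 3) :0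
    := :cubic K :0 (x :* p :^ 2 :* y :* q :^ 2 :+ p :^ 3 :* (y :+ y :^ 2) :* q)
                   (x :* p :^ 2 :* q :^ 3 :+ 2 :× p :^ 3 :* y :* q :^ 2) (p :^ 3 :* q :^ 3)) ≈-refl

  -- With t = 0 and g₀ = 0, every remaining term of `cubic-sum` is divisible by its first argument;
  -- this is the source of the factor x³.
  b-numerator : ∀ x → let p = 1# - x ^ 1 ; y = x ^ 2 ; q = 1# - y in
    cubic-sum (x ^ 3) 0# 0# (x * p ^ 2 * y * q ^ 2 + p ^ 3 * (y + y ^ 2) * q)
                            (x * p ^ 2 * q ^ 3 + 2 · p ^ 3 * y * q ^ 2) (p ^ 3 * q ^ 3)
    ≈ ((1# - x) ^ 6 * (1# + x)) * (x ^ 3 * (6 · x ^ 8 + 14 · x ^ 7 + 18 · x ^ 6 + 21 · x ^ 5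
        + 23 · x ^ 4 + 15 · x ^ 3 + 7 · x ^ 2 + 3 · x + 1#))
  b-numerator = solve 1 (λ x → let p = :1 :- x :^ 1 ; y = x :^ 2 ; q = :1 :- y in
    :cubic-sum (x :^ 3) :0 :0 (x :* p :^ 2 :* y :* q :^ 2 :+ p :^ 3 :* (y :+ y :^ 2) :* q)
                              (x :* p :^ 2 :* q :^ 3 :+ 2 :× p :^ 3 :* y :* q :^ 2) (p :^ 3 :* q :^ 3)
    := ((:1 :- x) :^ 6 :* (:1 :+ x)) :* (x :^ 3 :* (6 :× x :^ 8 :+ 14 :× x :^ 7 :+ 18 :× x :^ 6
        :+ 21 :× x :^ 5 :+ 23 :× x :^ 4 :+ 15 :× x :^ 3 :+ 7 :× x :^ 2 :+ 3 :× x :+ :1))) ≈-refl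

  -- From 1 - x² = (1 - x)(1 + x) and 1 - x³ = (1 - x)(x² + x + 1).
  b-denominator : ∀ x →
    ((1# - x) ^ 6 * (1# + x)) * ((1# - x) ^ 6 * (1# + x) ^ 3 * (x ^ 2 + x + 1#) ^ 4)
    ≈ (1# - x ^ 3) ^ 4 * ((1# - x ^ 2) ^ 4 * ((1# - x ^ 1) ^ 4 * 1#))
  b-denominator = solve 1 (λ x →
    ((:1 :- x) :^ 6 :* (:1 :+ x)) :* ((:1 :- x) :^ 6 :* (:1 :+ x) :^ 3 :* (x :^ 2 :+ x :+ :1) :^ 4)
    := (:1 :- x :^ 3) :^ 4 :* ((:1 :- x :^ 2) :^ 4 :* ((:1 :- x :^ 1) :^ 4 :* :1))) ≈-refl

  -- Elimination of the indices in an abstract ring.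

  -- S = ∑_{j ≥ 0} y^j G j, expressed by uniqueness of the solution of a recurrence.
  IsSum : (y : Carrier) (G : ℕ → Carrier) (S : Carrier) → Set _
  IsSum y G S = ∀ c (F : ℕ → Carrier) → (∀ j → F j ≈ c * G j + y * F (suc j)) → F 0 ≈ c * S

  -- The values of `cubic-sum` at t = 0, 1, 2, ... satisfy the recurrence with factor (1 - y)⁴ c, so
  -- `IsSum` determines the one at 0.
  sum-cubic : ∀ y G S c g₀ g₁ g₂ g₃ → IsSum y G S →
    (∀ k → c * G k ≈ cubic (k · 1#) g₀ g₁ g₂ g₃) →
    ((1# - y) ^ 4 * c) * S ≈ cubic-sum y 0# g₀ g₁ g₂ g₃
  sum-cubic y G S c g₀ g₁ g₂ g₃ isSum cG≈cubic = CommutativeRing.sym R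
    (isSum ((1# - y) ^ 4 * c) (λ j → cubic-sum y (j · 1#) g₀ g₁ g₂ g₃)
      (λ j → cubic-sum-unfold y c (G j) j g₀ g₁ g₂ g₃ (cG≈cubic j)))

  module _ (x : Carrier) (row : ℕ → Carrier) (S : Carrier)
           (row-sum : ∀ k → IsSum (x ^ 1) (λ m → a-summand k m · 1#) (row k))
           (S-sum : IsSum (x ^ 2) row S)
           {k} (K : (C P Q : Carrier) → Set k)
           (K-intro : ∀ C P Q → (C * Q) * (x ^ 3 * S) ≈ C * P → K C P Q)
           where
    a-rational : Fractions.A-Fraction _+_ _*_ _-_ 1# _^_ _·_ x K
    a-rational = record { property = K-intro C (x ^ 3 * N) Q (begin
      (C * Q) * (x ^ 3 * S)    ≈⟨ *-congʳ (a-denominator x) ⟩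
      D * (x ^ 3 * S)          ≈⟨ x∙yz≈y∙xz D (x ^ 3) S ⟩
      x ^ 3 * (D * S)          ≈⟨ *-congˡ (sum-cubic (x ^ 2) row S D′ _ _ _ _ S-sum row-cubic) ⟩
      x ^ 3 * _                ≈⟨ *-congˡ (a-numerator x) ⟩
      x ^ 3 * (C * N)          ≈⟨ x∙yz≈y∙xz (x ^ 3) C N ⟩
      C * (x ^ 3 * N)          ∎) }
      where
      p = 1# - x ^ 1
      C = (1# - x) ^ 4 * (1# + x)
      N = 2 · x ^ 3 + 11 · x ^ 2 + 11 · x + 12 · 1#
      Q = (1# - x) ^ 4 * (1# + x) ^ 3
      D′ = (1# - x ^ 1) ^ 4 * 1#
      D = (1# - x ^ 2) ^ 4 * D′

      -- The four coefficients are those of `a-row-cubic`.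
      row-cubic : ∀ k → D′ * row k ≈ cubic (k · 1#) _ _ _ _
      row-cubic k = begin
        D′ * row k   ≈⟨ sum-cubic (x ^ 1) (λ m → a-summand k m · 1#) (row k) 1# _ _ _ _
                          (row-sum k) (a-summand-cubic k) ⟩
        _            ≈⟨ a-row-cubic x (k · 1#) ⟩
        _            ∎

  module _ (x : Carrier) (row : ℕ → ℕ → Carrier) (layer : ℕ → Carrier) (S : Carrier)
           (row-sum : ∀ k v → IsSum (x ^ 1) (λ w → b-summand k v w · 1#) (row k v))
           (layer-sum : ∀ k → IsSum (x ^ 2) (row k) (layer k))
           (S-sum : IsSum (x ^ 3) layer S)
           {k} (K : (C P Q : Carrier) → Set k)
           (K-intro : ∀ C P Q → (C * Q) * S ≈ C * P → K C P Q)
           where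
    b-rational : Fractions.B-Fraction _+_ _*_ _-_ 1# _^_ _·_ x K
    b-rational = record { property = K-intro C P Q (begin
      (C * Q) * S    ≈⟨ *-congʳ (b-denominator x) ⟩
      D * S          ≈⟨ sum-cubic (x ^ 3) layer S D″ 0# _ _ _ S-sum layer-cubic ⟩
      _              ≈⟨ b-numerator x ⟩
      C * P          ∎) }
      where
      C = (1# - x) ^ 6 * (1# + x)
      P = x ^ 3 * (6 · x ^ 8 + 14 · x ^ 7 + 18 · x ^ 6 + 21 · x ^ 5
                   + 23 · x ^ 4 + 15 · x ^ 3 + 7 · x ^ 2 + 3 · x + 1#)
      Q = (1# - x) ^ 6 * (1# + x) ^ 3 * (x ^ 2 + x + 1#) ^ 4
      D′ = (1# - x ^ 1) ^ 4 * 1#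
      D″ = (1# - x ^ 2) ^ 4 * D′
      D = (1# - x ^ 3) ^ 4 * D″

      row-cubic : ∀ k v → D′ * row k v ≈ cubic (v · 1#) _ _ _ _
      row-cubic k v = begin
        D′ * row k v   ≈⟨ sum-cubic (x ^ 1) (λ w → b-summand k v w · 1#) (row k v) 1# _ _ _ _
                            (row-sum k v) (b-summand-cubic k v) ⟩
        _              ≈⟨ b-row-cubic x (k · 1#) (v · 1#) ⟩
        _              ∎

      layer-cubic : ∀ k → D″ * layer k ≈ cubic (k · 1#) _ _ _ _
      layer-cubic k = begin
        D″ * layer k   ≈⟨ sum-cubic (x ^ 2) (row k) (layer k) D′ _ _ _ _ (layer-sum k) (row-cubic k) ⟩
        _              ≈⟨ b-layer-cubic x (k · 1#) ⟩
        _              ∎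

open import Defs

-- The commutative ring of formal power series.

*-cong : ∀ {f f′ g g′} → f ≈ f′ → g ≈ g′ → f * g ≈ f′ * g′
*-cong f≈f′ g≈g′ n = ℤ-Sum.sum-cong-≗ {suc n}
  (λ i → cong₂ ℤ._*_ (f≈f′ (toℕ i)) (g≈g′ (n ∸ toℕ i)))

-- The mirror image of (f * g) (suc n) = f 0 g (suc n) + ((f ∘ suc) * g) n, which
-- holds by computation.
*-suc : ∀ f g n → (f * g) (suc n) ≡ (f * (g ∘ suc)) n ℤ.+ f (suc n) ℤ.* g 0
*-suc f g zero = solve 4
  (λ f₀ f₁ g₀ g₁ → f₀ :* g₁ :+ (f₁ :* g₀ :+ con 0ℤ) := f₀ :* g₁ :+ con 0ℤ :+ f₁ :* g₀)
  refl (f 0) (f 1) (g 0) (g 1)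
  where open ℤ.+-*-Solver
*-suc f g (suc n) = trans
  (cong (ℤ._+_ (f 0 ℤ.* g (suc (suc n)))) (*-suc (f ∘ suc) g n))
  (sym (ℤ.+-assoc (f 0 ℤ.* g (suc (suc n))) _ _))

-- Taking the first term off `f * g` and the last off `g * f` leaves products of the tail of `f`
-- with `g`, one degree lower.
*-comm : ∀ f g → f * g ≈ g * f
*-comm f g zero = cong (ℤ._+ 0ℤ) (ℤ.*-comm (f 0) (g 0))
*-comm f g (suc n) = begin
  f 0 ℤ.* g (suc n) ℤ.+ ((f ∘ suc) * g) n
    ≡⟨ cong₂ ℤ._+_ (ℤ.*-comm (f 0) _) (*-comm (f ∘ suc) g n) ⟩
  g (suc n) ℤ.* f 0 ℤ.+ (g * (f ∘ suc)) n
    ≡⟨ ℤ.+-comm (g (suc n) ℤ.* f 0) _ ⟩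
  (g * (f ∘ suc)) n ℤ.+ g (suc n) ℤ.* f 0
    ≡⟨ *-suc g f n ⟨
  (g * f) (suc n) ∎
  where open ≡-Reasoning

*-distribʳ-+ : ∀ h f g → (f + g) * h ≈ f * h + g * h
*-distribʳ-+ h f g n = trans
  (ℤ-Sum.sum-cong-≗ {suc n} (λ i → ℤ.*-distribʳ-+ (h (n ∸ toℕ i)) (f (toℕ i)) (g (toℕ i))))
  (ℤ-Sum.∑-distrib-+ {suc n} (λ i → f (toℕ i) ℤ.* h (n ∸ toℕ i)) (λ i → g (toℕ i) ℤ.* h (n ∸ toℕ i)))

*-distribˡ-+ : ∀ h f g → h * (f + g) ≈ h * f + h * g
*-distribˡ-+ h f g n = begin
  (h * (f + g)) n           ≡⟨ *-comm h (f + g) n ⟩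
  ((f + g) * h) n           ≡⟨ *-distribʳ-+ h f g n ⟩
  (f * h) n ℤ.+ (g * h) n   ≡⟨ cong₂ ℤ._+_ (*-comm f h n) (*-comm g h n) ⟩
  (h * f) n ℤ.+ (h * g) n   ∎
  where open ≡-Reasoning

-- For associativity, where the tail of `f * g` contains the multiple of the tail of `g` by the
-- constant `f 0`.
scale-* : ∀ c f g n → ((λ m → c ℤ.* f m) * g) n ≡ c ℤ.* (f * g) n
scale-* c f g zero = solve 3
  (λ c f₀ g₀ → c :* f₀ :* g₀ :+ con 0ℤ := c :* (f₀ :* g₀ :+ con 0ℤ)) refl c (f 0) (g 0)
  where open ℤ.+-*-Solver
scale-* c f g (suc n) = begin
  c ℤ.* f 0 ℤ.* g (suc n) ℤ.+ ((λ m → c ℤ.* f (suc m)) * g) n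
    ≡⟨ cong₂ ℤ._+_ (ℤ.*-assoc c (f 0) _) (scale-* c (f ∘ suc) g n) ⟩
  c ℤ.* (f 0 ℤ.* g (suc n)) ℤ.+ c ℤ.* ((f ∘ suc) * g) n
    ≡⟨ ℤ.*-distribˡ-+ c (f 0 ℤ.* g (suc n)) _ ⟨
  c ℤ.* (f * g) (suc n) ∎
  where open ≡-Reasoning

-- The tail of `f * g` is `f 0` times the tail of `g`, plus the tail of `f` times `g`.
-- Distributivity and `scale-*` then reduce the claim to the tail of `f`, one degree lower.
*-assoc : ∀ f g h → (f * g) * h ≈ f * (g * h)
*-assoc f g h zero = solve 3
  (λ f₀ g₀ h₀ → (f₀ :* g₀ :+ con 0ℤ) :* h₀ :+ con 0ℤ := f₀ :* (g₀ :* h₀ :+ con 0ℤ) :+ con 0ℤ)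
  refl (f 0) (g 0) (h 0)
  where open ℤ.+-*-Solver
*-assoc f g h (suc n) = begin
  (f 0 ℤ.* g 0 ℤ.+ 0ℤ) ℤ.* h (suc n) ℤ.+ (((λ m → f 0 ℤ.* g (suc m)) + (f ∘ suc) * g) * h) n
    ≡⟨ cong (ℤ._+_ ((f 0 ℤ.* g 0 ℤ.+ 0ℤ) ℤ.* h (suc n)))
         (trans (*-distribʳ-+ h (λ m → f 0 ℤ.* g (suc m)) ((f ∘ suc) * g) n)
           (cong₂ ℤ._+_ (scale-* (f 0) (g ∘ suc) h n) (*-assoc (f ∘ suc) g h n))) ⟩
  (f 0 ℤ.* g 0 ℤ.+ 0ℤ) ℤ.* h (suc n)
    ℤ.+ (f 0 ℤ.* ((g ∘ suc) * h) n ℤ.+ ((f ∘ suc) * (g * h)) n)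
    ≡⟨ regroup (f 0) (g 0) (h (suc n)) (((g ∘ suc) * h) n) (((f ∘ suc) * (g * h)) n) ⟩
  f 0 ℤ.* (g 0 ℤ.* h (suc n) ℤ.+ ((g ∘ suc) * h) n) ℤ.+ ((f ∘ suc) * (g * h)) n ∎
  where
  open ≡-Reasoning
  open ℤ.+-*-Solver
  regroup : ∀ a b c d e →
    (a ℤ.* b ℤ.+ 0ℤ) ℤ.* c ℤ.+ (a ℤ.* d ℤ.+ e) ≡ a ℤ.* (b ℤ.* c ℤ.+ d) ℤ.+ e
  regroup = solve 5 (λ a b c d e →
    (a :* b :+ con 0ℤ) :* c :+ (a :* d :+ e) := a :* (b :* c :+ d) :+ e) refl

0#-* : ∀ f → 0# * f ≈ 0#
0#-* f n = ℤ-Sum.sum-replicate-zero (suc n)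

*-identityˡ : ∀ f → 1# * f ≈ f
*-identityˡ f zero    = trans (ℤ.+-identityʳ _) (ℤ.*-identityˡ (f 0))
*-identityˡ f (suc n) = trans
  (cong₂ ℤ._+_ (ℤ.*-identityˡ (f (suc n))) (0#-* f n))
  (ℤ.+-identityʳ (f (suc n)))

series-isCommutativeRing : IsCommutativeRing _≈_ _+_ _*_ -_ 0# 1#
series-isCommutativeRing = record
  { isRing = record
    { +-isAbelianGroup = record
      { isGroup = record
        { isMonoid = record
          { isSemigroup = record
            { isMagma = record
              { isEquivalence = record
                { refl = λ _ → refl ; sym = λ p n → sym (p n) ; trans = λ p q n → trans (p n) (q n) }
              ; ∙-cong = λ p q n → cong₂ ℤ._+_ (p n) (q n)
              }
            ; assoc = λ f g h n → ℤ.+-assoc (f n) (g n) (h n)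
            }
          ; identity = (λ f n → ℤ.+-identityˡ (f n)) , (λ f n → ℤ.+-identityʳ (f n))
          }
        ; inverse = (λ f n → ℤ.+-inverseˡ (f n)) , (λ f n → ℤ.+-inverseʳ (f n))
        ; ⁻¹-cong = λ p n → cong ℤ.-_ (p n)
        }
      ; comm = λ f g n → ℤ.+-comm (f n) (g n)
      }
    ; *-cong = *-cong
    ; *-assoc = *-assoc
    ; *-identity = *-identityˡ , λ f n → trans (*-comm f 1# n) (*-identityˡ f n)
    ; distrib = *-distribˡ-+ , *-distribʳ-+
    }
  ; *-comm = *-comm
  }

series-commutativeRing : CommutativeRing 0ℓ 0ℓ
series-commutativeRing = record { isCommutativeRing = series-isCommutativeRing }

·1#-zero : ∀ n → (n · 1#) 0 ≡ + n
·1#-zero zero    = refl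
·1#-zero (suc n) = cong (ℤ._+_ 1ℤ) (·1#-zero n)

·1#-suc : ∀ n m → (n · 1#) (suc m) ≡ 0ℤ
·1#-suc zero    m = refl
·1#-suc (suc n) m = trans (ℤ.+-identityˡ _) (·1#-suc n m)

open CommutativeRing series-commutativeRing
  using (*-congˡ; *-congʳ; setoid; *-commutativeSemigroup)
  renaming (refl to ≈-refl; trans to ≈-trans)
open CommutativeSemigroupProperties *-commutativeSemigroup using (x∙yz≈yx∙z)
open Identities series-commutativeRing using (IsSum; *-scale-unfold; a-rational; b-rational)

-- Multiplication by powers of X.

X*-suc : ∀ f n → (X * f) (suc n) ≡ f n
X*-suc f n = begin
  0ℤ ℤ.* f (suc n) ℤ.+ ((X ∘ suc) * f) n   ≡⟨ ℤ.+-identityˡ _ ⟩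
  ((X ∘ suc) * f) n                        ≡⟨ *-cong {g = f} X∘suc≈1# ≈-refl n ⟩
  (1# * f) n                               ≡⟨ *-identityˡ f n ⟩
  f n                                      ∎
  where
  open ≡-Reasoning
  X∘suc≈1# : (X ∘ suc) ≈ 1#
  X∘suc≈1# zero    = refl
  X∘suc≈1# (suc _) = refl

X^-< : ∀ d f {n} → n ℕ.< d → (X ^ d * f) n ≡ 0ℤ
-- The constant term of a multiple of `X` computes to 0, so associativity already closes this case.
X^-< (suc d) f {zero}  _           = *-assoc X (X ^ d) f 0
X^-< (suc d) f {suc n} (s≤s n<d) = begin
  (X ^ suc d * f) (suc n)       ≡⟨ *-assoc X (X ^ d) f (suc n) ⟩
  (X * (X ^ d * f)) (suc n)     ≡⟨ X*-suc (X ^ d * f) n ⟩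
  (X ^ d * f) n                 ≡⟨ X^-< d f n<d ⟩
  0ℤ                            ∎
  where open ≡-Reasoning

X^-+ : ∀ d f n → (X ^ d * f) (d ℕ.+ n) ≡ f n
X^-+ zero    f n = *-identityˡ f n
X^-+ (suc d) f n = begin
  (X ^ suc d * f) (suc d ℕ.+ n)       ≡⟨ *-assoc X (X ^ d) f (suc d ℕ.+ n) ⟩
  (X * (X ^ d * f)) (suc d ℕ.+ n)     ≡⟨ X*-suc (X ^ d * f) (d ℕ.+ n) ⟩
  (X ^ d * f) (d ℕ.+ n)               ≡⟨ X^-+ d f n ⟩
  f n                                 ∎
  where open ≡-Reasoning

-- Sums over multiples of d, and the recurrence that determines them.

-- ∑_{k ≥ 0} X^{dk} G k
⅀ : ∀ d .{{_ : ℕ.NonZero d}} → (ℕ → Series) → Series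
⅀ d G n = ℤ-Sum.sum {suc (n div d)} (λ k → G (toℕ k) (n ∸ toℕ k ℕ.* d))

module _ (d : ℕ) .{{_ : ℕ.NonZero d}} where

  <⊎+ : ∀ n → n ℕ.< d ⊎ ∃ λ m → n ≡ d ℕ.+ m
  <⊎+ n with n ℕ.<? d
  ... | yes n<d = inj₁ n<d
  ... | no  n≮d = inj₂ (n ∸ d , sym (ℕ.m+[n∸m]≡n (ℕ.≮⇒≥ n≮d)))

  -- If n < d, only the term k = 0 is in range. If n = d + m, then n div d is 1 + m div d, and the
  -- terms with k ≥ 1 are those of the shifted sum at m.
  ⅀-unfold : ∀ G → ⅀ d G ≈ G 0 + X ^ d * ⅀ d (G ∘ suc)
  ⅀-unfold G n with <⊎+ n
  ... | inj₁ n<d = begin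
    ⅀ d G n                       ≡⟨ cong (λ q → ℤ-Sum.sum {suc q} (λ k → G (toℕ k) (n ∸ toℕ k ℕ.* d)))
                                          (ℕ.m<n⇒m/n≡0 n<d) ⟩
    G 0 n ℤ.+ 0ℤ                  ≡⟨ cong (ℤ._+_ (G 0 n)) (X^-< d (⅀ d (G ∘ suc)) n<d) ⟨
    (G 0 + X ^ d * ⅀ d (G ∘ suc)) n ∎
    where open ≡-Reasoning
  ... | inj₂ (m , refl) = begin
    ⅀ d G (d ℕ.+ m)
      ≡⟨ cong (λ q → ℤ-Sum.sum {suc q} (λ k → G (toℕ k) (d ℕ.+ m ∸ toℕ k ℕ.* d)))
           (trans (ℕ.m/n≡1+[m∸n]/n {d ℕ.+ m} {d} (ℕ.m≤m+n d m))
             (cong (λ l → suc (l div d)) (ℕ.m+n∸m≡n d m))) ⟩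
    G 0 (d ℕ.+ m) ℤ.+ ℤ-Sum.sum {suc (m div d)} (λ k → G (suc (toℕ k)) (d ℕ.+ m ∸ (d ℕ.+ toℕ k ℕ.* d)))
      ≡⟨ cong (ℤ._+_ (G 0 (d ℕ.+ m))) (ℤ-Sum.sum-cong-≗ {suc (m div d)} (λ k →
           cong (G (suc (toℕ k))) (ℕ.[m+n]∸[m+o]≡n∸o d m (toℕ k ℕ.* d)))) ⟩
    G 0 (d ℕ.+ m) ℤ.+ ⅀ d (G ∘ suc) m
      ≡⟨ cong (ℤ._+_ (G 0 (d ℕ.+ m))) (X^-+ d (⅀ d (G ∘ suc)) m) ⟨
    (G 0 + X ^ d * ⅀ d (G ∘ suc)) (d ℕ.+ m) ∎
    where open ≡-Reasoning

  -- Since d > 0, coefficient n of `X ^ d * f` is either 0 or an earlier coefficient of `f`. This is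
  -- why the recurrence determines its solution.
  X^-cong-< : ∀ f g n → (∀ {m} → m ℕ.< n → f m ≡ g m) → (X ^ d * f) n ≡ (X ^ d * g) n
  X^-cong-< f g n f≡g with <⊎+ n
  ... | inj₁ n<d        = trans (X^-< d f n<d) (sym (X^-< d g n<d))
  ... | inj₂ (m , refl) = begin
    (X ^ d * f) (d ℕ.+ m)   ≡⟨ X^-+ d f m ⟩
    f m                     ≡⟨ f≡g (ℕ.m<n+m m (ℕ.>-nonZero⁻¹ d)) ⟩
    g m                     ≡⟨ X^-+ d g m ⟨
    (X ^ d * g) (d ℕ.+ m)   ∎
    where open ≡-Reasoning

  -- By `⅀-unfold`, `c * ⅀ d G` obeys the same recurrence as `F 0`; strong induction on the degree
  -- compares the two.
  ⅀-unique : ∀ c F G → (∀ j → F j ≈ c * G j + X ^ d * F (suc j)) → F 0 ≈ c * ⅀ d G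
  ⅀-unique c F G F-unfold n = <-rec P step n F G F-unfold
    where
    -- `F` and `G` are quantified because the induction hypothesis is applied to their shifts.
    P : ℕ → Set
    P n = ∀ F G → (∀ j → F j ≈ c * G j + X ^ d * F (suc j)) → F 0 n ≡ (c * ⅀ d G) n

    *-⅀-unfold : ∀ G → c * ⅀ d G ≈ c * G 0 + X ^ d * (c * ⅀ d (G ∘ suc))
    *-⅀-unfold G = ≈-trans {c * ⅀ d G} (*-congˡ {c} (⅀-unfold G))
      (*-scale-unfold c (G 0) (X ^ d) (⅀ d (G ∘ suc)))

    step : ∀ n → (∀ {m} → m ℕ.< n → P m) → P n
    step n rec F G F-unfold = begin
      F 0 n
        ≡⟨ F-unfold 0 n ⟩
      (c * G 0) n ℤ.+ (X ^ d * F 1) n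
        ≡⟨ cong (ℤ._+_ ((c * G 0) n)) (X^-cong-< (F 1) (c * ⅀ d (G ∘ suc)) n
             (λ m<n → rec m<n (F ∘ suc) (G ∘ suc) (F-unfold ∘ suc))) ⟩
      (c * G 0 + X ^ d * (c * ⅀ d (G ∘ suc))) n
        ≡⟨ *-⅀-unfold G n ⟨
      (c * ⅀ d G) n ∎
      where open ≡-Reasoning

-- In the innermost sum the exponent of `X` is the index itself, so its value is the series with
-- coefficients `f n`. The tails `T j` of this series solve the recurrence, which identifies it with
-- `⅀ 1`.
IsSum-sequence : ∀ (f : ℕ → ℕ) → IsSum (X ^ 1) (λ k → f k · 1#) (λ n → + f n)
IsSum-sequence f c F F-unfold n = trans (⅀-unique 1 c F (λ k → f k · 1#) F-unfold n)
  (*-congˡ {c} ⅀≈f n)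
  where
  T : ℕ → Series
  T j n = + f (j ℕ.+ n)

  T-unfold : ∀ j n → T j n ≡ (f j · 1#) n ℤ.+ (X ^ 1 * T (suc j)) n
  T-unfold j zero = begin
    + f (j ℕ.+ 0)                                   ≡⟨ cong (λ l → + f l) (ℕ.+-identityʳ j) ⟩
    + f j                                           ≡⟨ ℤ.+-identityʳ (+ f j) ⟨
    + f j ℤ.+ 0ℤ                                    ≡⟨ cong₂ ℤ._+_ (·1#-zero (f j)) (X^-< 1 (T (suc j)) (s≤s z≤n)) ⟨
    (f j · 1#) 0 ℤ.+ (X ^ 1 * T (suc j)) 0          ∎
    where open ≡-Reasoning
  T-unfold j (suc n) = begin
    + f (j ℕ.+ suc n)                               ≡⟨ cong (λ l → + f l) (ℕ.+-suc j n) ⟩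
    T (suc j) n                                     ≡⟨ ℤ.+-identityˡ (T (suc j) n) ⟨
    0ℤ ℤ.+ T (suc j) n                              ≡⟨ cong₂ ℤ._+_ (·1#-suc (f j) n) (X^-+ 1 (T (suc j)) n) ⟨
    (f j · 1#) (suc n) ℤ.+ (X ^ 1 * T (suc j)) (suc n) ∎
    where open ≡-Reasoning

  ⅀≈f : ⅀ 1 (λ k → f k · 1#) ≈ T 0
  ⅀≈f n = sym (trans
    -- Uniqueness at c = 1: the factor `1#` is inserted into the recurrence and removed from the
    -- conclusion.
    (⅀-unique 1 1# T (λ k → f k · 1#) (λ j n → trans (T-unfold j n)
      (cong (λ c → c ℤ.+ (X ^ 1 * T (suc j)) n) (sym (*-identityˡ (f j · 1#) n)))) n)
    (*-identityˡ (⅀ 1 (λ k → f k · 1#)) n))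

-- Cancellation in quotients of series.

-- `C * Q` has constant term 1, hence an inverse. Its products with `S` and with `P / Q` both equal
-- `C * P`, so it cancels.
/-unique : ∀ C P Q S {Q₀≡1} → (C * Q) 0 ≡ 1ℤ → (C * Q) * S ≈ C * P → S ≈ (P / Q) {Q₀≡1}
/-unique C P Q S {Q₀≡1} [CQ]₀≡1 CQS≈CP = begin
  S                       ≈⟨ cancel S ⟨
  I * ((C * Q) * S)       ≈⟨ *-congˡ {I} CQS≈CP ⟩
  I * (C * P)             ≈⟨ *-congˡ {I} (*-congˡ {C} (*-/-cancel P Q {Q₀≡1})) ⟨
  I * (C * (Q * R))       ≈⟨ *-congˡ {I} (*-assoc C Q R) ⟨
  I * ((C * Q) * R)       ≈⟨ cancel R ⟩
  R                       ∎
  where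
  open SetoidReasoning setoid
  R = (P / Q) {Q₀≡1}
  [CQ]₀≟1 : True ((C * Q) 0 ℤ.≟ 1ℤ)
  [CQ]₀≟1 = fromWitness [CQ]₀≡1
  I = (1# / (C * Q)) {[CQ]₀≟1}
  cancel : ∀ f → I * ((C * Q) * f) ≈ f
  cancel f = begin
    I * ((C * Q) * f)     ≈⟨ x∙yz≈yx∙z I (C * Q) f ⟩
    ((C * Q) * I) * f     ≈⟨ *-congʳ {f} (*-/-cancel 1# (C * Q) {[CQ]₀≟1}) ⟩
    1# * f                ≈⟨ *-identityˡ f ⟩
    f                     ∎

-- Reindexing the coefficients of A and B.

-- Agreement is asked only for k < N, because the substitutions of indices rest on subtractions that
-- may truncate beyond the range of summation.
pos-sum : ∀ N (f : ℕ → ℕ) (g : ℕ → ℤ) → (∀ k → k ℕ.< N → + f k ≡ g k) →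
  + ℕ-Sum.sum {N} (f ∘ toℕ) ≡ ℤ-Sum.sum {N} (g ∘ toℕ)
pos-sum zero    f g f≡g = refl
pos-sum (suc N) f g f≡g = cong₂ ℤ._+_ (f≡g 0 (s≤s z≤n))
  (pos-sum N (f ∘ suc) (g ∘ suc) (λ k k<N → f≡g (suc k) (s≤s k<N)))

-- Justifies the substitution n = kd + m: within the range of `⅀ d` the subtraction is exact.
k<1+n/d⇒n≡[n∸kd]+kd : ∀ d .{{_ : ℕ.NonZero d}} {n k} →
  k ℕ.< suc (n div d) → n ≡ n ∸ k ℕ.* d ℕ.+ k ℕ.* d
k<1+n/d⇒n≡[n∸kd]+kd d {n} {k} (s≤s k≤n/d) = sym (ℕ.m∸n+n≡m
  (ℕ.≤-trans (ℕ.*-monoˡ-≤ d k≤n/d) (ℕ.m/n*n≤m n d)))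

a-row : ℕ → Series
a-row k m = + a-summand k m

a≡⅀ : ∀ n → + a (3 ℕ.+ n) ≡ ⅀ 2 a-row n
a≡⅀ n = trans
  (cong (λ q → + ℕ-Sum.sum {q} (λ j → summand (1 ℕ.+ toℕ j)))
    -- The number of terms, (n + 2) div 2, becomes 1 + n div 2, the length of `⅀ 2 a-row n`.
    (ℕ.m/n≡1+[m∸n]/n {2 ℕ.+ n} {2} (s≤s (s≤s z≤n))))
  (pos-sum (suc (n div 2)) (summand ∘ suc) (λ k → a-row k (n ∸ k ℕ.* 2))
    (λ k k<N → cong +_ (summand-suc k k<N)))
  where
  open ℕ.+-*-Solver

  summand : ℕ → ℕ
  summand k = 2 ℕ.* k ℕ.^ 2 ℕ.+ 2 ℕ.* (3 ℕ.+ n ∸ k) ℕ.^ 2 ℕ.+ k ℕ.* (3 ℕ.+ n ∸ k)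

  index : ∀ k m → 2 ℕ.+ (m ℕ.+ k ℕ.* 2) ∸ k ≡ 2 ℕ.+ (k ℕ.+ m)
  index k m = trans
    (cong (_∸ k) (solve 2 (λ k m →
      con 2 :+ (m :+ k :* con 2) := con 2 :+ (k :+ m) :+ k) refl k m))
    (ℕ.m+n∸n≡m (2 ℕ.+ (k ℕ.+ m)) k)

  summand-suc : ∀ k → k ℕ.< suc (n div 2) → summand (suc k) ≡ a-summand k (n ∸ k ℕ.* 2)
  summand-suc k k<N = cong (λ j → 2 ℕ.* (1 ℕ.+ k) ℕ.^ 2 ℕ.+ 2 ℕ.* j ℕ.^ 2 ℕ.+ (1 ℕ.+ k) ℕ.* j)
    (trans (cong (λ l → 2 ℕ.+ l ∸ k) (k<1+n/d⇒n≡[n∸kd]+kd 2 k<N)) (index k (n ∸ k ℕ.* 2)))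

-- `a 1` and `a 2` are empty sums and `A` has constant term 0, so the series starts in degree 3.
A≈X³⅀ : A ≈ X ^ 3 * ⅀ 2 a-row
A≈X³⅀ 0 = sym (X^-< 3 (⅀ 2 a-row) (s≤s z≤n))
A≈X³⅀ 1 = sym (X^-< 3 (⅀ 2 a-row) (s≤s (s≤s z≤n)))
A≈X³⅀ 2 = sym (X^-< 3 (⅀ 2 a-row) (s≤s (s≤s (s≤s z≤n))))
A≈X³⅀ (suc (suc (suc n))) = trans (a≡⅀ n) (sym (X^-+ 3 (⅀ 2 a-row) n))

b-row : ℕ → ℕ → Series
b-row k v w = + b-summand k v w

b-layer : ℕ → Series
b-layer k = ⅀ 2 (b-row k)

-- With n = m + 3k the upper limit is k + m div 2, so i = k + v with 0 ≤ v ≤ m div 2. For w = m - 2v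
-- the factor n - i - k becomes k + v + w.
b-inner≡⅀ : ∀ k m → let n = m ℕ.+ k ℕ.* 3 in
  + (∑[ i from k to (n ∸ k) div 2 ] i ℕ.* k ℕ.* (n ∸ i ∸ k)) ≡ b-layer k m
b-inner≡⅀ k m = trans
  (cong (λ q → + ℕ-Sum.sum {q} (λ j → summand (k ℕ.+ toℕ j))) size)
  (pos-sum (suc (m div 2)) (summand ∘ (k ℕ.+_)) (λ v → b-row k v (m ∸ v ℕ.* 2))
    (λ v v<N → cong +_ (summand-+ v v<N)))
  where
  open ≡-Reasoning
  open ℕ.+-*-Solver
  n = m ℕ.+ k ℕ.* 3

  summand : ℕ → ℕ
  summand i = i ℕ.* k ℕ.* (n ∸ i ∸ k)

  size : suc ((n ∸ k) div 2) ∸ k ≡ suc (m div 2)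
  size = begin
    suc ((n ∸ k) div 2) ∸ k
      ≡⟨ cong (λ l → suc ((l ∸ k) div 2) ∸ k) (solve 2 (λ k m →
           m :+ k :* con 3 := m :+ k :* con 2 :+ k) refl k m) ⟩
    suc ((m ℕ.+ k ℕ.* 2 ℕ.+ k ∸ k) div 2) ∸ k
      ≡⟨ cong (λ l → suc (l div 2) ∸ k) (ℕ.m+n∸n≡m (m ℕ.+ k ℕ.* 2) k) ⟩
    suc ((m ℕ.+ k ℕ.* 2) div 2) ∸ k
      ≡⟨ cong (λ l → suc l ∸ k) (trans (ℕ.+-distrib-/-∣ʳ m {k ℕ.* 2} {2} (ℕ.divides k refl))
           (cong (m div 2 ℕ.+_) (ℕ.m*n/n≡m k 2))) ⟩
    suc (m div 2) ℕ.+ k ∸ k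
      ≡⟨ ℕ.m+n∸n≡m (suc (m div 2)) k ⟩
    suc (m div 2) ∎

  index : ∀ v w → w ℕ.+ v ℕ.* 2 ℕ.+ k ℕ.* 3 ∸ (k ℕ.+ v) ∸ k ≡ k ℕ.+ v ℕ.+ w
  index v w = begin
    w ℕ.+ v ℕ.* 2 ℕ.+ k ℕ.* 3 ∸ (k ℕ.+ v) ∸ k
      ≡⟨ ℕ.∸-+-assoc (w ℕ.+ v ℕ.* 2 ℕ.+ k ℕ.* 3) (k ℕ.+ v) k ⟩
    w ℕ.+ v ℕ.* 2 ℕ.+ k ℕ.* 3 ∸ (k ℕ.+ v ℕ.+ k)
      ≡⟨ cong (_∸ (k ℕ.+ v ℕ.+ k)) (solve 3 (λ k v w →
           w :+ v :* con 2 :+ k :* con 3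
           := k :+ v :+ w :+ (k :+ v :+ k)) refl k v w) ⟩
    k ℕ.+ v ℕ.+ w ℕ.+ (k ℕ.+ v ℕ.+ k) ∸ (k ℕ.+ v ℕ.+ k)
      ≡⟨ ℕ.m+n∸n≡m (k ℕ.+ v ℕ.+ w) (k ℕ.+ v ℕ.+ k) ⟩
    k ℕ.+ v ℕ.+ w ∎

  summand-+ : ∀ v → v ℕ.< suc (m div 2) → summand (k ℕ.+ v) ≡ b-summand k v (m ∸ v ℕ.* 2)
  summand-+ v v<N = cong₂ ℕ._*_ (ℕ.*-comm (k ℕ.+ v) k)
    (trans (cong (λ l → l ℕ.+ k ℕ.* 3 ∸ (k ℕ.+ v) ∸ k) (k<1+n/d⇒n≡[n∸kd]+kd 2 v<N))
      (index v (m ∸ v ℕ.* 2)))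

-- The extra term k = 0 of ⅀ 3 b-layer vanishes, since b-summand 0 v w is 0.
b≡⅀ : ∀ n → + b n ≡ ⅀ 3 b-layer n
b≡⅀ n = begin
  + b n
    ≡⟨ pos-sum (n div 3) (inner ∘ suc) (λ k → b-layer (suc k) (n ∸ suc k ℕ.* 3)) (λ k k<N →
         trans (cong (λ l → + (∑[ i from suc k to (l ∸ suc k) div 2 ] i ℕ.* suc k ℕ.* (l ∸ i ∸ suc k)))
                  -- The index is `suc k`, which is at most n div 3 because k < n div 3.
                  (k<1+n/d⇒n≡[n∸kd]+kd 3 {n} {suc k} (s≤s k<N)))
               (b-inner≡⅀ (suc k) (n ∸ suc k ℕ.* 3))) ⟩
  ℤ-Sum.sum {n div 3} (λ k → b-layer (suc (toℕ k)) (n ∸ suc (toℕ k) ℕ.* 3))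
    ≡⟨ ℤ.+-identityˡ _ ⟨
  0ℤ ℤ.+ ℤ-Sum.sum {n div 3} (λ k → b-layer (suc (toℕ k)) (n ∸ suc (toℕ k) ℕ.* 3))
    ≡⟨ cong (ℤ._+ ℤ-Sum.sum {n div 3} (λ k → b-layer (suc (toℕ k)) (n ∸ suc (toℕ k) ℕ.* 3)))
         (ℤ-Sum.sum-replicate-zero (suc (n div 2))) ⟨
  ⅀ 3 b-layer n ∎
  where
  open ≡-Reasoning
  inner : ℕ → ℕ
  inner k = ∑[ i from k to (n ∸ k) div 2 ] i ℕ.* k ℕ.* (n ∸ i ∸ k)

B≈⅀ : B ≈ ⅀ 3 b-layer
-- `b 0` is an empty sum, which agrees with the constant term 0 of `B`.
B≈⅀ zero    = b≡⅀ 0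
B≈⅀ (suc n) = b≡⅀ (suc n)

theorem8 : (A ≈ (X ^ 3 * (2 · X ^ 3 + 11 · X ^ 2 + 11 · X + 12 · 1#))
    / ((1# - X) ^ 4 * (1# + X) ^ 3))
    ×
    (B ≈ (X ^ 3 * (6 · X ^ 8 + 14 · X ^ 7 + 18 · X ^ 6 + 21 · X ^ 5 + 23 · X ^ 4 + 15 · X ^ 3 + 7 · X ^ 2 + 3 · X + 1#))
    / ((1# - X) ^ 6 * (1# + X) ^ 3 * (X ^ 2 + X + 1#) ^ 4))
-- Each `refl` computes the constant term of the full denominator, surplus factor included, to 1.
theorem8 = (λ n → trans (A≈X³⅀ n) (A-Fraction.property A-fraction refl n))
         , (λ n → trans (B≈⅀ n) (B-Fraction.property B-fraction refl n))
  where
  -- The constant term of `C * Q` is kept as a premise, since `K-intro` must hold for arbitrary `C`,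
  -- `P` and `Q`.
  IsQuotient : Series → (C P Q : Series) → Set
  IsQuotient S C P Q = {Q₀≡1 : True (Q 0 ℤ.≟ 1ℤ)} → (C * Q) 0 ≡ 1ℤ → S ≈ (P / Q) {Q₀≡1}

  open Fractions _+_ _*_ _-_ 1# _^_ _·_ X using (A-Fraction; B-Fraction)

  A-fraction : A-Fraction (IsQuotient (X ^ 3 * ⅀ 2 a-row))
  A-fraction = a-rational X a-row (⅀ 2 a-row)
    (λ k → IsSum-sequence (a-summand k)) (λ c F → ⅀-unique 2 c F a-row)
    (IsQuotient (X ^ 3 * ⅀ 2 a-row)) (λ C P Q p {Q₀≡1} q → /-unique C P Q (X ^ 3 * ⅀ 2 a-row) {Q₀≡1} q p)

  B-fraction : B-Fraction (IsQuotient (⅀ 3 b-layer))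
  B-fraction = b-rational X b-row b-layer (⅀ 3 b-layer)
    (λ k v → IsSum-sequence (b-summand k v))
    (λ k c F → ⅀-unique 2 c F (b-row k)) (λ c F → ⅀-unique 3 c F b-layer)
    (IsQuotient (⅀ 3 b-layer)) (λ C P Q p {Q₀≡1} q → /-unique C P Q (⅀ 3 b-layer) {Q₀≡1} q p)
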